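{- There is a uniform effective interpretation of $F$ in $H(F)$: there is a single computable sequence of generalized computable $\Sigma_1$ formulas in the language of groups, with no parameters, which for every field $F$ (with universe a subset of $\omega$) defines an effective interpretation of $F$ in $H(F)$.
   Context: All languages are computable and all structures have universe a subset of $\omega$. For a field $F$, $H(F)$ is the group under matrix multiplication of all matrices $h(a,b,c)=\begin{pmatrix}1&a&c\\0&1&b\\0&0&1\end{pmatrix}$, $a,b,c\in F$. Fields are viewed as relational structures $(F,\mathrm{graph}(+),\mathrm{graph}(\cdot))$. For a structure $\mathcal{B}$, a set $R\subseteq\mathcal{B}^{<\omega}$ (tuples of all finite lengths) has a generalized computable $\Sigma_1$ definition if there is a computable sequence $(\varphi_n(x_1,\dots,x_n))_{n\in\omega}$ of computable infinitary $\Sigma_1$ formulas such that each $\varphi_n$ defines $R\cap\mathcal{B}^n$. A relational structure $\mathcal{A}=(A,(R_i)_{i\in I})$, $R_i$ of arity $k_i$, is effectively interpreted in $\mathcal{B}$ if there are $D\subseteq\mathcal{B}^{<\omega}$, a relation $\sim$ on $D$ and relations $R_i^*\subseteq D^{k_i}$ such that $(D,(R_i^*)_i)/\!\sim\;\cong\mathcal{A}$ (in particular $\sim$ is an equivalence relation compatible with the $R_i^*$), and there is a computable sequence of generalized computable $\Sigma_1$ formulas with no parameters defining $D$, $\sim$, the complement of $\sim$ in $D^2$, each $R_i^*$, and the complement of each $R_i^*$ in $D^{k_i}$. -}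

module Defs where

open import Level using (0ℓ)
import Data.Nat
open import Data.Nat using (ℕ) renaming (_+_ to _+ℕ_)
open import Data.Fin using (Fin; zero; suc)
open import Data.Vec using (Vec; []; _∷_; _++_; lookup)
open import Data.Product using (Σ; Σ-syntax; ∃; _×_; _,_; proj₁; proj₂)
open import Data.Unit using (⊤)
open import Data.Empty using (⊥)
open import Data.Sum using (_⊎_)
open import Relation.Nullary using (¬_)
open import Relation.Binary.PropositionalEquality using (_≡_)
open import Function.Bundles using (_⇔_)
open import Algebra.Bundles using (CommutativeRing)

record Field : Set₁ where
  field
    commRing : CommutativeRing 0ℓ 0ℓ
  open CommutativeRing commRing public
  field
    0≉1     : ¬ (0# ≈ 1#)
    inverse : ∀ x → ¬ (x ≈ 0#) → Σ[ y ∈ Carrier ] (x * y ≈ 1#)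

-- A field whose universe is a subset of ω: the elements (up to the
-- field's equality) are coded injectively by natural numbers.
record FieldOnω : Set₁ where
  field
    field′   : Field
  open Field field′ public
  field
    code     : Carrier → ℕ
    code-resp : ∀ {x y} → x ≈ y → code x ≡ code y
    code-inj  : ∀ {x y} → code x ≡ code y → x ≈ y

record GroupLangStr : Set₁ where
  field
    Carrier : Set
    _≈_     : Carrier → Carrier → Set
    _∙_     : Carrier → Carrier → Carrier
    _⁻¹     : Carrier → Carrier
    ε       : Carrier

module Heisenberg (F : FieldOnω) where
  open FieldOnω F using (Carrier; _≈_; _+_; _*_; -_; 0#; 1#)
  open import Data.Fin using (zero; suc)

  Mat3 : Set
  Mat3 = Fin 3 → Fin 3 → Carrier

  _⊗_ : Mat3 → Mat3 → Mat3
  (M ⊗ N) i j = M i zero * N zero j + M i (suc zero) * N (suc zero) j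
                + M i (suc (suc zero)) * N (suc (suc zero)) j

  h : Carrier → Carrier → Carrier → Mat3
  h a b c zero zero = 1#
  h a b c zero (suc zero) = a
  h a b c zero (suc (suc zero)) = c
  h a b c (suc zero) zero = 0#
  h a b c (suc zero) (suc zero) = 1#
  h a b c (suc zero) (suc (suc zero)) = b
  h a b c (suc (suc zero)) zero = 0#
  h a b c (suc (suc zero)) (suc zero) = 0#
  h a b c (suc (suc zero)) (suc (suc zero)) = 1#

  Elt : Set
  Elt = Carrier × Carrier × Carrier

  mat : Elt → Mat3
  mat (a , b , c) = h a b c

  _≈H_ : Elt → Elt → Set
  x ≈H y = ∀ i j → mat x i j ≈ mat y i j

  -- matrix product, read back as a triple (the product of two such
  -- matrices is again of this form)
  _∙H_ : Elt → Elt → Elt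
  x ∙H y = (M zero (suc zero) , M (suc zero) (suc (suc zero)) , M zero (suc (suc zero)))
    where M = mat x ⊗ mat y

  invH : Elt → Elt
  invH (a , b , c) = (- a , - b , a * b + - c)

  eH : Elt
  eH = (0# , 0# , 0#)

H : FieldOnω → GroupLangStr
H F = record
  { Carrier = Heisenberg.Elt F
  ; _≈_ = Heisenberg._≈H_ F
  ; _∙_ = Heisenberg._∙H_ F
  ; _⁻¹ = Heisenberg.invH F
  ; ε = Heisenberg.eH F
  }

data Term (n : ℕ) : Set where
  var  : Fin n → Term n
  e    : Term n
  _·_  : Term n → Term n → Term n
  inv  : Term n → Term n

data QF (n : ℕ) : Set where
  _≐_  : Term n → Term n → QF n
  ⊤′ ⊥′ : QF n
  ¬′_  : QF n → QF n
  _∧′_ _∨′_ : QF n → QF n → QF n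

record ExFormula (n : ℕ) : Set where
  constructor ∃[_]_
  field
    k    : ℕ
    body : QF (n +ℕ k)

-- A computable infinitary Σ₁ formula: a computably enumerated
-- disjunction ⋁_i ∃ȳ ψ_i. Computable enumerations are rendered as
-- (necessarily computable) Agda functions ℕ → ExFormula n.
Σ₁ : ℕ → Set
Σ₁ n = ℕ → ExFormula n

total : ∀ {k} → Vec ℕ k → ℕ
total []       = Data.Nat.zero
total (n ∷ ns) = n +ℕ total ns

-- A generalized computable Σ₁ formula for a k-ary relation on B^{<ω}:
-- a computable family, indexed by the lengths (n₁,…,n_k) of the k tuples,
-- of computable Σ₁ formulas in n₁+…+n_k free variables.
GenΣ₁ : ℕ → Set
GenΣ₁ k = (ns : Vec ℕ k) → Σ₁ (total ns)

module Sem (B : GroupLangStr) where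
  open GroupLangStr B

  ⟦_⟧ₜ : ∀ {n} → Term n → (Fin n → Carrier) → Carrier
  ⟦ var i ⟧ₜ ρ = ρ i
  ⟦ e ⟧ₜ ρ = ε
  ⟦ s · t ⟧ₜ ρ = ⟦ s ⟧ₜ ρ ∙ ⟦ t ⟧ₜ ρ
  ⟦ inv t ⟧ₜ ρ = ⟦ t ⟧ₜ ρ ⁻¹

  ⟦_⟧q : ∀ {n} → QF n → (Fin n → Carrier) → Set
  ⟦ s ≐ t ⟧q ρ = ⟦ s ⟧ₜ ρ ≈ ⟦ t ⟧ₜ ρ
  ⟦ ⊤′ ⟧q ρ = ⊤
  ⟦ ⊥′ ⟧q ρ = ⊥
  ⟦ ¬′ φ ⟧q ρ = ¬ ⟦ φ ⟧q ρ
  ⟦ φ ∧′ ψ ⟧q ρ = ⟦ φ ⟧q ρ × ⟦ ψ ⟧q ρ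
  ⟦ φ ∨′ ψ ⟧q ρ = ⟦ φ ⟧q ρ ⊎ ⟦ ψ ⟧q ρ

  ⟦_⟧∃ : ∀ {n} → ExFormula n → Vec Carrier n → Set
  ⟦ ∃[ k ] ψ ⟧∃ xs = Σ[ ys ∈ Vec Carrier k ] ⟦ ψ ⟧q (lookup (xs ++ ys))

  ⟦_⟧Σ : ∀ {n} → Σ₁ n → Vec Carrier n → Set
  ⟦ φ ⟧Σ xs = Σ[ i ∈ ℕ ] ⟦ φ i ⟧∃ xs

  Tuple : Set
  Tuple = Σ[ n ∈ ℕ ] Vec Carrier n

  lens : ∀ {k} → Vec Tuple k → Vec ℕ k
  lens []             = []
  lens ((n , _) ∷ ts) = n ∷ lens ts

  concatT : ∀ {k} → (ts : Vec Tuple k) → Vec Carrier (total (lens ts))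
  concatT []             = []
  concatT ((_ , v) ∷ ts) = v ++ concatT ts

  Defines : ∀ {k} → GenΣ₁ k → (Vec Tuple k → Set) → Set
  Defines φ R = ∀ ts → ⟦ φ (lens ts) ⟧Σ (concatT ts) ⇔ R ts

-- the data of an (intended) effective interpretation of a field:
-- generalized computable Σ₁ formulas (no parameters) for D, ∼, its
-- complement in D², graph(+)*, its complement in D³, graph(·)*, and its
-- complement in D³.
record InterpFormulas : Set where
  field
    φDom  : GenΣ₁ 1
    φEq   : GenΣ₁ 2
    φNEq  : GenΣ₁ 2
    φAdd  : GenΣ₁ 3
    φNAdd : GenΣ₁ 3
    φMul  : GenΣ₁ 3
    φNMul : GenΣ₁ 3

-- The isomorphism (D,(R*))/∼ ≅ F is expressed (there being no quotient
-- types) by a surjection f : D → F whose kernel is ∼ and which pulls the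
-- relations graph(+), graph(·) of F back exactly to R₊*, R·*.
record DefinesEffInterp (Φ : InterpFormulas) (B : GroupLangStr) (F : FieldOnω) : Set₁ where
  open InterpFormulas Φ
  open Sem B
  module F = FieldOnω F
  field
    D   : Tuple → Set
    _∼_ : Tuple → Tuple → Set
    R₊  : Tuple → Tuple → Tuple → Set
    R·  : Tuple → Tuple → Tuple → Set
    ∼⊆D² : ∀ {x y} → x ∼ y → D x × D y
    R₊⊆D³ : ∀ {x y z} → R₊ x y z → D x × D y × D z
    R·⊆D³ : ∀ {x y z} → R· x y z → D x × D y × D z
    defD    : Defines φDom  (λ { (x ∷ []) → D x })
    def∼    : Defines φEq   (λ { (x ∷ y ∷ []) → x ∼ y })
    def≁    : Defines φNEq  (λ { (x ∷ y ∷ []) → D x × D y × ¬ (x ∼ y) })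
    defR₊   : Defines φAdd  (λ { (x ∷ y ∷ z ∷ []) → R₊ x y z })
    defNR₊  : Defines φNAdd (λ { (x ∷ y ∷ z ∷ []) → D x × D y × D z × ¬ R₊ x y z })
    defR·   : Defines φMul  (λ { (x ∷ y ∷ z ∷ []) → R· x y z })
    defNR·  : Defines φNMul (λ { (x ∷ y ∷ z ∷ []) → D x × D y × D z × ¬ R· x y z })
    f       : ∀ x → D x → F.Carrier
    f-surj  : ∀ a → Σ[ x ∈ Tuple ] Σ[ d ∈ D x ] (f x d F.≈ a)
    f-ker   : ∀ x y (dx : D x) (dy : D y) → (x ∼ y) ⇔ (f x dx F.≈ f y dy)
    f-add   : ∀ x y z (dx : D x) (dy : D y) (dz : D z) →
              R₊ x y z ⇔ ((f x dx F.+ f y dy) F.≈ f z dz)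
    f-mul   : ∀ x y z (dx : D x) (dy : D y) (dz : D z) →
              R· x y z ⇔ ((f x dx F.* f y dy) F.≈ f z dz)

-- In H(F) every commutator is central: [x, y] = h(0, 0, det(π x, π y)), where π x ∈ F² collects
-- the two off-centre entries of x. A quadruple (u, v, p, q) with [u, v] ≠ 1, [u, p] = [q, v] = 1
-- and [p, v] = [u, q] therefore has p ≡ t u and q ≡ t v modulo the centre for a unique scalar t,
-- by Cramer's rule in the basis (π u, π v); the quadruple codes t. Two codes are compared through
-- commutators with the other basis, and codes over a common basis (u, v) add and multiply through
-- [p, v] [P, v] = [P', v] and [p, Q] = [P', v]. Bringing the arguments to the common basis of the
-- first one needs existential witnesses, and since every choice of witnesses gives the same
-- answer, the complements of the graphs of + and · are existentially definable too.
module Submission where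

open import Level using (0ℓ)
open import Algebra.Bundles using (CommutativeRing; RawRing)
import Data.Nat as ℕ
open import Data.Nat.Properties using (_≟_)
open import Data.Fin using (zero; suc; _↑ˡ_; _↑ʳ_)
open import Data.Vec using (Vec; []; _∷_; _++_; lookup; tabulate)
open import Data.Maybe using (Maybe; just; nothing)
open import Data.Empty using (⊥)
open import Data.Product using (Σ; Σ-syntax; _×_; _,_; proj₁; proj₂)
open import Data.Product.Relation.Binary.Pointwise.NonDependent using (Pointwise; ×-setoid)
open import Data.Product.Function.NonDependent.Propositional using (_×-⇔_)
open import Relation.Nullary using (¬_; Dec; yes; no)
open import Relation.Binary.Bundles using (Setoid)
import Relation.Binary.PropositionalEquality as ≡
open ≡ using (_≡_)
open import Function.Base using (_∘_)
open import Function.Bundles using (_⇔_; mk⇔; Equivalence)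
open import Function.Properties.Equivalence using () renaming (refl to ⇔-refl; trans to ⇔-trans)
open import Defs

-- Ring solver with integer coefficients

module CommutativeRingSolver {c ℓ} (R : CommutativeRing c ℓ) where
  open import Data.Nat using (ℕ; zero; suc; _∸_)
  open import Algebra.Solver.Ring.AlmostCommutativeRing
    using (fromCommutativeRing; _-Raw-AlmostCommutative⟶_)
  open CommutativeRing R
  open import Algebra.Properties.Semiring.Mult semiring using (×-homo-+; ×1-homo-*)
    renaming (_×_ to _⊠_)
  open import Algebra.Properties.AbelianGroup +-abelianGroup using (⁻¹-∙-comm; ⁻¹-anti-homo‿-)
  open import Algebra.Properties.Group +-group using (ε⁻¹≈ε)
  open import Algebra.Properties.Ring ring using (x[y-z]≈xy-xz; [y-z]x≈yx-zx)
  open import Algebra.Properties.CommutativeSemigroup +-commutativeSemigroup using (interchange)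
  open import Relation.Binary.Reasoning.Setoid setoid

  -- Integer coefficients m - n, normalised so that m or n is 0: the solver can only drop a
  -- coefficient it recognises as syntactically zero, as it must be to cancel x - x.
  Difference : Set
  Difference = ℕ × ℕ

  normalise : Difference → Difference
  normalise (m , n) = m ∸ n , n ∸ m

  Differences : RawRing 0ℓ 0ℓ
  Differences = record
    { Carrier = Difference
    ; _≈_ = _≡_
    ; _+_ = λ (a , b) (c , d) → normalise (a ℕ.+ c , b ℕ.+ d)
    ; _*_ = λ (a , b) (c , d) → normalise (a ℕ.* c ℕ.+ b ℕ.* d , a ℕ.* d ℕ.+ b ℕ.* c)
    ; -_ = λ (a , b) → b , a
    ; 0# = 0 , 0
    ; 1# = 1 , 0
    }

  ⟦_⟧ᶜ : Difference → Carrier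
  ⟦ m , n ⟧ᶜ = m ⊠ 1# - n ⊠ 1#

  [x+y]-[z+w]≈[x-z]+[y-w] : ∀ x y z w → (x + y) - (z + w) ≈ (x - z) + (y - w)
  [x+y]-[z+w]≈[x-z]+[y-w] x y z w = begin
    (x + y) - (z + w)     ≈⟨ +-congˡ (⁻¹-∙-comm z w) ⟨
    (x + y) + (- z + - w) ≈⟨ interchange x y (- z) (- w) ⟩
    (x - z) + (y - w)     ∎

  [x-y][z-w]≈[xz+yw]-[xw+yz] : ∀ x y z w → (x - y) * (z - w) ≈ (x * z + y * w) - (x * w + y * z)
  [x-y][z-w]≈[xz+yw]-[xw+yz] x y z w = begin
    (x - y) * (z - w)                 ≈⟨ [y-z]x≈yx-zx (z - w) x y ⟩
    x * (z - w) - y * (z - w)         ≈⟨ +-cong (x[y-z]≈xy-xz x z w) (-‿cong (x[y-z]≈xy-xz y z w)) ⟩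
    (x * z - x * w) - (y * z - y * w) ≈⟨ +-congˡ (⁻¹-anti-homo‿- (y * z) (y * w)) ⟩
    (x * z - x * w) + (y * w - y * z) ≈⟨ [x+y]-[z+w]≈[x-z]+[y-w] (x * z) (y * w) (x * w) (y * z) ⟨
    (x * z + y * w) - (x * w + y * z) ∎

  normalise-sound : ∀ d → ⟦ normalise d ⟧ᶜ ≈ ⟦ d ⟧ᶜ
  normalise-sound (zero , zero) = refl
  normalise-sound (zero , suc n) = refl
  normalise-sound (suc m , zero) = refl
  normalise-sound (suc m , suc n) = begin
    ⟦ normalise (m , n) ⟧ᶜ                ≈⟨ normalise-sound (m , n) ⟩
    m ⊠ 1# - n ⊠ 1#                       ≈⟨ +-identityˡ _ ⟨
    0# + (m ⊠ 1# - n ⊠ 1#)                ≈⟨ +-congʳ (-‿inverseʳ 1#) ⟨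
    (1# - 1#) + (m ⊠ 1# - n ⊠ 1#)         ≈⟨ [x+y]-[z+w]≈[x-z]+[y-w] 1# (m ⊠ 1#) 1# (n ⊠ 1#) ⟨
    ⟦ suc m , suc n ⟧ᶜ                    ∎

  homomorphism : Differences -Raw-AlmostCommutative⟶ fromCommutativeRing R
  homomorphism = record
    { ⟦_⟧ = ⟦_⟧ᶜ
    ; +-homo = λ (a , b) (c , d) → begin
        ⟦ normalise (a ℕ.+ c , b ℕ.+ d) ⟧ᶜ      ≈⟨ normalise-sound (a ℕ.+ c , b ℕ.+ d) ⟩
        (a ℕ.+ c) ⊠ 1# - (b ℕ.+ d) ⊠ 1#         ≈⟨ +-cong (×-homo-+ 1# a c) (-‿cong (×-homo-+ 1# b d)) ⟩
        (a ⊠ 1# + c ⊠ 1#) - (b ⊠ 1# + d ⊠ 1#)  ≈⟨ [x+y]-[z+w]≈[x-z]+[y-w] _ _ _ _ ⟩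
        ⟦ a , b ⟧ᶜ + ⟦ c , d ⟧ᶜ                  ∎
    ; *-homo = λ (a , b) (c , d) → begin
        ⟦ normalise (a ℕ.* c ℕ.+ b ℕ.* d , a ℕ.* d ℕ.+ b ℕ.* c) ⟧ᶜ
          ≈⟨ normalise-sound (a ℕ.* c ℕ.+ b ℕ.* d , a ℕ.* d ℕ.+ b ℕ.* c) ⟩
        (a ℕ.* c ℕ.+ b ℕ.* d) ⊠ 1# - (a ℕ.* d ℕ.+ b ℕ.* c) ⊠ 1#
          ≈⟨ +-cong (multiples a c b d) (-‿cong (multiples a d b c)) ⟩
        (a ⊠ 1# * c ⊠ 1# + b ⊠ 1# * d ⊠ 1#) - (a ⊠ 1# * d ⊠ 1# + b ⊠ 1# * c ⊠ 1#)
          ≈⟨ [x-y][z-w]≈[xz+yw]-[xw+yz] _ _ _ _ ⟨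
        ⟦ a , b ⟧ᶜ * ⟦ c , d ⟧ᶜ
          ∎
    ; -‿homo = λ (a , b) → sym (⁻¹-anti-homo‿- (a ⊠ 1#) (b ⊠ 1#))
    ; 0-homo = -‿inverseʳ 0#
    ; 1-homo = trans (+-cong (+-identityʳ 1#) ε⁻¹≈ε) (+-identityʳ 1#)
    }
    where
    multiples : ∀ a c b d → (a ℕ.* c ℕ.+ b ℕ.* d) ⊠ 1# ≈ a ⊠ 1# * c ⊠ 1# + b ⊠ 1# * d ⊠ 1#
    multiples a c b d =
      trans (×-homo-+ 1# (a ℕ.* c) (b ℕ.* d)) (+-cong (×1-homo-* a c) (×1-homo-* b d))

  _≟ᶜ_ : ∀ x y → Maybe (⟦ x ⟧ᶜ ≈ ⟦ y ⟧ᶜ)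
  (a , b) ≟ᶜ (c , d) with a ≟ c | b ≟ d
  ... | yes ≡.refl | yes ≡.refl = just refl
  ... | _          | _          = nothing

  open import Algebra.Solver.Ring Differences (fromCommutativeRing R) homomorphism _≟ᶜ_
    public using (solve; _:=_; _:+_; _:*_; :-_; _:-_)

module _ {c ℓ} (S : Setoid c ℓ) where
  open Setoid S

  ≈-resp-⇔ : ∀ {a a' b b'} → a ≈ a' → b ≈ b' → (a ≈ b ⇔ a' ≈ b')
  ≈-resp-⇔ a≈a' b≈b' =
    mk⇔ (λ a≈b → trans (sym a≈a') (trans a≈b b≈b')) (λ a'≈b' → trans a≈a' (trans a'≈b' (sym b≈b')))

-- Determinants of pairs

module Determinant {c ℓ} (R : CommutativeRing c ℓ) where
  open CommutativeRing R
  open CommutativeRingSolver R using (solve; _:=_; _:+_; _:*_; _:-_)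
  open import Relation.Binary.Reasoning.Setoid setoid

  R² : Set c
  R² = Carrier × Carrier

  infix 4 _≈²_
  infixr 7 _⋆_

  _≈²_ : R² → R² → Set ℓ
  _≈²_ = Pointwise _≈_ _≈_

  module ≈² = Setoid (×-setoid setoid setoid)

  _⋆_ : Carrier → R² → R²
  t ⋆ (a , b) = t * a , t * b

  ⋆-congʳ : ∀ {s t} x → s ≈ t → s ⋆ x ≈² t ⋆ x
  ⋆-congʳ _ s≈t = *-congʳ s≈t , *-congʳ s≈t

  det : R² → R² → Carrier
  det (a , b) (c , d) = a * d - b * c

  det-cong : ∀ {x x' y y'} → x ≈² x' → y ≈² y' → det x y ≈ det x' y'
  det-cong (a , b) (c , d) = +-cong (*-cong a d) (-‿cong (*-cong b c))

  det-self : ∀ x → det x x ≈ 0#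
  det-self (a , b) = trans (+-congˡ (-‿cong (*-comm b a))) (-‿inverseʳ (a * b))

  det-⋆ˡ : ∀ t x y → det (t ⋆ x) y ≈ t * det x y
  det-⋆ˡ t (a , b) (c , d) =
    solve 5 (λ t a b c d → (t :* a) :* d :- (t :* b) :* c := t :* (a :* d :- b :* c)) refl t a b c d

  det-⋆ʳ : ∀ t x y → det x (t ⋆ y) ≈ t * det x y
  det-⋆ʳ t (a , b) (c , d) =
    solve 5 (λ t a b c d → a :* (t :* d) :- b :* (t :* c) := t :* (a :* d :- b :* c)) refl t a b c d

  det-proportionalˡ : ∀ {x t u} w → x ≈² t ⋆ u → det x w ≈ t * det u w
  det-proportionalˡ {t = t} {u} w x≈tu = trans (det-cong x≈tu (refl , refl)) (det-⋆ˡ t u w)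

  det-proportionalʳ : ∀ {x t u} w → x ≈² t ⋆ u → det w x ≈ t * det w u
  det-proportionalʳ {t = t} {u} w x≈tu = trans (det-cong (refl , refl) x≈tu) (det-⋆ʳ t w u)

  cramer₁ : ∀ u v w → det u v * proj₁ w ≈ det w v * proj₁ u + det u w * proj₁ v
  cramer₁ (u₁ , u₂) (v₁ , v₂) (w₁ , w₂) =
    solve 6 (λ u₁ u₂ v₁ v₂ w₁ w₂ →
      (u₁ :* v₂ :- u₂ :* v₁) :* w₁ := (w₁ :* v₂ :- w₂ :* v₁) :* u₁ :+ (u₁ :* w₂ :- u₂ :* w₁) :* v₁)
      refl u₁ u₂ v₁ v₂ w₁ w₂

  cramer₂ : ∀ u v w → det u v * proj₂ w ≈ det w v * proj₂ u + det u w * proj₂ v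
  cramer₂ (u₁ , u₂) (v₁ , v₂) (w₁ , w₂) =
    solve 6 (λ u₁ u₂ v₁ v₂ w₁ w₂ →
      (u₁ :* v₂ :- u₂ :* v₁) :* w₂ := (w₁ :* v₂ :- w₂ :* v₁) :* u₂ :+ (u₁ :* w₂ :- u₂ :* w₁) :* v₂)
      refl u₁ u₂ v₁ v₂ w₁ w₂

  det-*-det : ∀ u v u' v' → det u v * det u' v' ≈ det u u' * det v v' - det u v' * det v u'
  det-*-det (a , b) (c , d) (a' , b') (c' , d') =
    solve 8 (λ a b c d a' b' c' d' →
      (a :* d :- b :* c) :* (a' :* d' :- b' :* c')
        := (a :* b' :- b :* a') :* (c :* d' :- d :* c') :- (a :* d' :- b :* c') :* (c :* b' :- d :* a'))
      refl a b c d a' b' c' d'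

  private
    isolate : ∀ {d y a A b B} → d * y ≈ 1# → d * a ≈ A * b + B → B ≈ 0# → a ≈ (A * y) * b
    isolate {d} {y} {a} {A} {b} {B} d*y≈1 eq B≈0 = begin
      a                  ≈⟨ *-identityˡ a ⟨
      1# * a             ≈⟨ *-congʳ d*y≈1 ⟨
      (d * y) * a        ≈⟨ solve 3 (λ d y a → (d :* y) :* a := y :* (d :* a)) refl d y a ⟩
      y * (d * a)        ≈⟨ *-congˡ (trans eq (trans (+-congˡ B≈0) (+-identityʳ (A * b)))) ⟩
      y * (A * b)        ≈⟨ solve 3 (λ y A b → y :* (A :* b) := (A :* y) :* b) refl y A b ⟩
      (A * y) * b        ∎

  -- In the basis (u, v), Cramer's rule gives w the coordinates det w v / det u v and det u w / det u v.
  proportionalˡ : ∀ {u v w y} → det u v * y ≈ 1# → det u w ≈ 0# → w ≈² (det w v * y) ⋆ u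
  proportionalˡ {u} {v} {w} d*y≈1 uw≈0 =
    isolate d*y≈1 (cramer₁ u v w) (vanish (proj₁ v)) , isolate d*y≈1 (cramer₂ u v w) (vanish (proj₂ v))
    where
    vanish : ∀ a → det u w * a ≈ 0#
    vanish a = trans (*-congʳ uw≈0) (zeroˡ a)

  proportionalʳ : ∀ {u v w y} → det u v * y ≈ 1# → det w v ≈ 0# → w ≈² (det u w * y) ⋆ v
  proportionalʳ {u} {v} {w} d*y≈1 wv≈0 =
    isolate d*y≈1 (trans (cramer₁ u v w) (+-comm _ _)) (vanish (proj₁ u)) ,
    isolate d*y≈1 (trans (cramer₂ u v w) (+-comm _ _)) (vanish (proj₂ u))
    where
    vanish : ∀ a → det w v * a ≈ 0#
    vanish a = trans (*-congʳ wv≈0) (zeroˡ a)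

module FieldDeterminant (K : Field) where
  open Field K
  open Determinant commRing
  open CommutativeRingSolver commRing using (solve; _:=_; _:*_; _:-_)
  open import Relation.Binary.Reasoning.Setoid setoid

  *-cancelʳ-⇔ : ∀ {d s t} → ¬ d ≈ 0# → (s * d ≈ t * d ⇔ s ≈ t)
  *-cancelʳ-⇔ {d} {s} {t} d≉0 = mk⇔ cancel *-congʳ
    where
    y = proj₁ (inverse d d≉0)
    d*y≈1 = proj₂ (inverse d d≉0)
    cancel : s * d ≈ t * d → s ≈ t
    cancel sd≈td = begin
      s             ≈⟨ *-identityʳ s ⟨
      s * 1#        ≈⟨ *-congˡ d*y≈1 ⟨
      s * (d * y)   ≈⟨ *-assoc s d y ⟨
      (s * d) * y   ≈⟨ *-congʳ sd≈td ⟩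
      (t * d) * y   ≈⟨ *-assoc t d y ⟩
      t * (d * y)   ≈⟨ *-congˡ d*y≈1 ⟩
      t * 1#        ≈⟨ *-identityʳ t ⟩
      t             ∎

  -- det u v * det u' v' is invertible and lies in the ideal generated by det u u' and det u v'.
  scalars-agree⇔ : ∀ {u v u' v' s t} → ¬ det u v ≈ 0# → ¬ det u' v' ≈ 0# →
    (s * det u u' ≈ t * det u u' × s * det u v' ≈ t * det u v') ⇔ s ≈ t
  scalars-agree⇔ {u} {v} {u'} {v'} {s} {t} uv≉0 u'v'≉0 = mk⇔ agree (λ s≈t → *-congʳ s≈t , *-congʳ s≈t)
    where
    expand : ∀ r → r * (det u v * det u' v') ≈ (r * det u u') * det v v' - (r * det u v') * det v u'
    expand r = trans (*-congˡ (det-*-det u v u' v'))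
      (solve 5 (λ r a b c d → r :* (a :* d :- b :* c) := (r :* a) :* d :- (r :* b) :* c)
        refl r (det u u') (det u v') (det v u') (det v v'))
    agree : s * det u u' ≈ t * det u u' × s * det u v' ≈ t * det u v' → s ≈ t
    agree (e₁ , e₂) =
      Equivalence.to (*-cancelʳ-⇔ uv≉0) (Equivalence.to (*-cancelʳ-⇔ u'v'≉0) (begin
        (s * det u v) * det u' v'                               ≈⟨ *-assoc s _ _ ⟩
        s * (det u v * det u' v')                               ≈⟨ expand s ⟩
        (s * det u u') * det v v' - (s * det u v') * det v u'
          ≈⟨ +-cong (*-congʳ e₁) (-‿cong (*-congʳ e₂)) ⟩
        (t * det u u') * det v v' - (t * det u v') * det v u'   ≈⟨ expand t ⟨
        t * (det u v * det u' v')                               ≈⟨ *-assoc t _ _ ⟨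
        (t * det u v) * det u' v'                               ∎))

-- The interpreting formulas and their meaning

module _ {W A : Set} {V Q : W → Set} (valid : A → Σ W V) where

  ∃-valid⇔ : ∀ {P : Set} → (∀ {w} → V w → Q w ⇔ P) → A → (Σ[ w ∈ W ] (V w × Q w)) ⇔ P
  ∃-valid⇔ decide a = mk⇔
    (λ (_ , v , q) → Equivalence.to (decide v) q)
    (λ p → let (w , v) = valid a in w , v , Equivalence.from (decide v) p)

  ∃-valid-¬⇔ : (∀ {w} → V w → A) → (∀ {w w'} → V w → V w' → Q w → Q w') →
               (Σ[ w ∈ W ] (V w × ¬ Q w)) ⇔ (A × ¬ (Σ[ w ∈ W ] (V w × Q w)))
  ∃-valid-¬⇔ valid⇒A independent = mk⇔
    (λ (_ , v , ¬q) → valid⇒A v , λ (_ , v' , q') → ¬q (independent v' v q'))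
    (λ (a , ¬∃) → let (w , v) = valid a in w , v , λ q → ¬∃ (w , v , q))

module _ {A : Set} where

  Lift₁ : (A → Set) → Maybe A → Set
  Lift₁ P (just a) = P a
  Lift₁ P nothing  = ⊥

  Lift₂ : (A → A → Set) → Maybe A → Maybe A → Set
  Lift₂ R (just a) (just b) = R a b
  Lift₂ R _        _        = ⊥

  Lift₃ : (A → A → A → Set) → Maybe A → Maybe A → Maybe A → Set
  Lift₃ R (just a) (just b) (just c) = R a b c
  Lift₃ R _        _        _        = ⊥

  Lift₂-⊆ : ∀ {P R} → (∀ {a b} → R a b → P a × P b) →
            ∀ m n → Lift₂ R m n → Lift₁ P m × Lift₁ P n
  Lift₂-⊆ R⊆P² (just a) (just b) r = R⊆P² r

  Lift₃-⊆ : ∀ {P R} → (∀ {a b c} → R a b c → P a × P b × P c) →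
            ∀ l m n → Lift₃ R l m n → Lift₁ P l × Lift₁ P m × Lift₁ P n
  Lift₃-⊆ R⊆P³ (just a) (just b) (just c) r = R⊆P³ r

  Lift₂-complement : ∀ {P R} m n →
    Lift₂ (λ a b → (P a × P b) × ¬ R a b) m n ⇔ (Lift₁ P m × Lift₁ P n × ¬ Lift₂ R m n)
  Lift₂-complement (just a) (just b) =
    mk⇔ (λ ((p , q) , ¬r) → p , q , ¬r) (λ (p , q , ¬r) → (p , q) , ¬r)
  Lift₂-complement nothing  _        = mk⇔ (λ ()) (λ ())
  Lift₂-complement (just a) nothing  = mk⇔ (λ ()) (λ ())

  Lift₃-complement : ∀ {P R} l m n →
    Lift₃ (λ a b c → (P a × P b × P c) × ¬ R a b c) l m n ⇔
    (Lift₁ P l × Lift₁ P m × Lift₁ P n × ¬ Lift₃ R l m n)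
  Lift₃-complement (just a) (just b) (just c) =
    mk⇔ (λ ((p , q , r) , ¬s) → p , q , r , ¬s) (λ (p , q , r , ¬s) → (p , q , r) , ¬s)
  Lift₃-complement nothing  _        _        = mk⇔ (λ ()) (λ ())
  Lift₃-complement (just a) nothing  _        = mk⇔ (λ ()) (λ ())
  Lift₃-complement (just a) (just b) nothing  = mk⇔ (λ ()) (λ ())

quadruple? : ∀ {A : Set} {n} → Dec (n ≡ 4) → Vec A n → Maybe (Vec A 4)
quadruple? (yes ≡.refl) xs = just xs
quadruple? (no _)       _  = nothing

⁅_,_⁆ᵗ : ∀ {n} → Term n → Term n → Term n
⁅ s , t ⁆ᵗ = (inv s · inv t) · (s · t)

block : ∀ o {m} → Vec (Term (o ℕ.+ (4 ℕ.+ m))) 4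
block o {m} = tabulate (λ i → var (o ↑ʳ (i ↑ˡ m)))

inDomainᶠ : ∀ {n} → Vec (Term n) 4 → QF n
inDomainᶠ (u ∷ v ∷ p ∷ q ∷ []) =
  (¬′ (⁅ u , v ⁆ᵗ ≐ e)) ∧′ ((⁅ u , p ⁆ᵗ ≐ e) ∧′ ((⁅ q , v ⁆ᵗ ≐ e) ∧′ (⁅ p , v ⁆ᵗ ≐ ⁅ u , q ⁆ᵗ)))

equivalentᶠ : ∀ {n} → Vec (Term n) 4 → Vec (Term n) 4 → QF n
equivalentᶠ (u ∷ _ ∷ p ∷ _ ∷ []) (u' ∷ v' ∷ p' ∷ q' ∷ []) =
  (⁅ p , u' ⁆ᵗ ≐ ⁅ u , p' ⁆ᵗ) ∧′ (⁅ p , v' ⁆ᵗ ≐ ⁅ u , q' ⁆ᵗ)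

sumᶠ productᶠ : ∀ {n} → Vec (Term n) 4 → Vec (Term n) 4 → QF n
sumᶠ     (_ ∷ v ∷ p ∷ _ ∷ []) (P₁ ∷ _ ∷ P₂ ∷ _ ∷ []) = (⁅ p , v ⁆ᵗ · ⁅ P₁ , v ⁆ᵗ) ≐ ⁅ P₂ , v ⁆ᵗ
productᶠ (_ ∷ v ∷ p ∷ _ ∷ []) (_ ∷ Q₁ ∷ P₂ ∷ _ ∷ []) = ⁅ p , Q₁ ⁆ᵗ ≐ ⁅ P₂ , v ⁆ᵗ

-- (u, v, P₁, Q₁) and (u, v, P₂, Q₂) for x = (u, v, p, q) and ws = (P₁, Q₁, P₂, Q₂), written with
-- lookup so that they compute on a witness vector that is only a variable.
witness₁ witness₂ : ∀ {A : Set} → Vec A 4 → Vec A 4 → Vec A 4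
witness₁ x ws = lookup x zero ∷ lookup x (suc zero) ∷ lookup ws zero ∷ lookup ws (suc zero) ∷ []
witness₂ x ws =
  lookup x zero ∷ lookup x (suc zero) ∷ lookup ws (suc (suc zero)) ∷ lookup ws (suc (suc (suc zero))) ∷ []

validᶠ : QF 16
validᶠ = inDomainᶠ x ∧′ (inDomainᶠ y ∧′ (inDomainᶠ z ∧′
         (inDomainᶠ w₁ ∧′ (equivalentᶠ w₁ y ∧′ (inDomainᶠ w₂ ∧′ equivalentᶠ w₂ z)))))
  where
  x y z ws w₁ w₂ : Vec (Term 16) 4
  x  = block 0
  y  = block 4
  z  = block 8
  ws = block 12
  w₁ = witness₁ x ws
  w₂ = witness₂ x ws

domainψ : ExFormula 4
domainψ = ∃[ 0 ] inDomainᶠ (block 0)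

pairψ : QF 8 → ExFormula 8
pairψ body = ∃[ 0 ] ((inDomainᶠ (block 0) ∧′ inDomainᶠ (block 4)) ∧′ body)

operationψ : QF 16 → ExFormula 12
operationψ body = ∃[ 4 ] (validᶠ ∧′ body)

⊥ᶠ : ∀ {n} → Σ₁ n
⊥ᶠ _ = ∃[ 0 ] ⊥′

finitary : ∀ {n} → ExFormula n → Σ₁ n
finitary ψ _ = ψ

ifQuadruple₁ : ∀ {n₁} → Dec (n₁ ≡ 4) → ExFormula 4 → Σ₁ (n₁ ℕ.+ 0)
ifQuadruple₁ (yes ≡.refl) ψ = finitary ψ
ifQuadruple₁ (no _)       _ = ⊥ᶠ

ifQuadruples₂ : ∀ {n₁ n₂} → Dec (n₁ ≡ 4) → Dec (n₂ ≡ 4) → ExFormula 8 → Σ₁ (n₁ ℕ.+ (n₂ ℕ.+ 0))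
ifQuadruples₂ (yes ≡.refl) (yes ≡.refl) ψ = finitary ψ
ifQuadruples₂ _            _            _ = ⊥ᶠ

ifQuadruples₃ : ∀ {n₁ n₂ n₃} → Dec (n₁ ≡ 4) → Dec (n₂ ≡ 4) → Dec (n₃ ≡ 4) → ExFormula 12 →
                Σ₁ (n₁ ℕ.+ (n₂ ℕ.+ (n₃ ℕ.+ 0)))
ifQuadruples₃ (yes ≡.refl) (yes ≡.refl) (yes ≡.refl) ψ = finitary ψ
ifQuadruples₃ _            _            _            _ = ⊥ᶠ

onQuadruples₁ : ExFormula 4 → GenΣ₁ 1
onQuadruples₁ ψ (n ∷ []) = ifQuadruple₁ (n ≟ 4) ψ

onQuadruples₂ : ExFormula 8 → GenΣ₁ 2
onQuadruples₂ ψ (n₁ ∷ n₂ ∷ []) = ifQuadruples₂ (n₁ ≟ 4) (n₂ ≟ 4) ψ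

onQuadruples₃ : ExFormula 12 → GenΣ₁ 3
onQuadruples₃ ψ (n₁ ∷ n₂ ∷ n₃ ∷ []) = ifQuadruples₃ (n₁ ≟ 4) (n₂ ≟ 4) (n₃ ≟ 4) ψ

equivalenceψ inequivalenceψ : ExFormula 8
equivalenceψ   = pairψ (equivalentᶠ (block 0) (block 4))
inequivalenceψ = pairψ (¬′ equivalentᶠ (block 0) (block 4))

sumψ nonsumψ productψ nonproductψ : ExFormula 12
sumψ        = operationψ (sumᶠ (block 0) (block 12))
nonsumψ     = operationψ (¬′ sumᶠ (block 0) (block 12))
productψ    = operationψ (productᶠ (block 0) (block 12))
nonproductψ = operationψ (¬′ productᶠ (block 0) (block 12))

Φ : InterpFormulas
Φ = record
  { φDom  = onQuadruples₁ domainψ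
  ; φEq   = onQuadruples₂ equivalenceψ
  ; φNEq  = onQuadruples₂ inequivalenceψ
  ; φAdd  = onQuadruples₃ sumψ
  ; φNAdd = onQuadruples₃ nonsumψ
  ; φMul  = onQuadruples₃ productψ
  ; φNMul = onQuadruples₃ nonproductψ
  }

module FormulaSemantics (B : GroupLangStr) where
  open GroupLangStr B
  open Sem B

  Quadruple : Set
  Quadruple = Vec Carrier 4

  InDomain : Quadruple → Set
  InDomain x = ⟦ inDomainᶠ (block 0) ⟧q (lookup x)

  Equivalent : Quadruple → Quadruple → Set
  Equivalent x y = ⟦ equivalentᶠ (block 0) (block 4) ⟧q (lookup (x ++ y))

  EquivalentInDomain : Quadruple → Quadruple → Set
  EquivalentInDomain x y = (InDomain x × InDomain y) × Equivalent x y

  Sum Product : Quadruple → Quadruple → Set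
  Sum     x ws = ⟦ sumᶠ     (block 0) (block 4) ⟧q (lookup (x ++ ws))
  Product x ws = ⟦ productᶠ (block 0) (block 4) ⟧q (lookup (x ++ ws))

  Valid : (x y z ws : Quadruple) → Set
  Valid x y z ws = InDomain x × InDomain y × InDomain z ×
                   InDomain w₁ × Equivalent w₁ y × InDomain w₂ × Equivalent w₂ z
    where
    w₁ = witness₁ x ws
    w₂ = witness₂ x ws

  Operation : (Quadruple → Quadruple → Set) → (x y z : Quadruple) → Set
  Operation Body x y z = Σ[ ws ∈ Quadruple ] (Valid x y z ws × Body x ws)

  asQuadruple : Tuple → Maybe Quadruple
  asQuadruple (n , xs) = quadruple? (n ≟ 4) xs

  ⟦finitary⟧ : ∀ {n} (ψ : ExFormula n) xs → ⟦ finitary ψ ⟧Σ xs ⇔ ⟦ ψ ⟧∃ xs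
  ⟦finitary⟧ _ _ = mk⇔ proj₂ (0 ,_)

  ⟦⊥ᶠ⟧ : ∀ {n} (xs : Vec Carrier n) → ⟦ ⊥ᶠ ⟧Σ xs ⇔ ⊥
  ⟦⊥ᶠ⟧ _ = mk⇔ (λ ()) (λ ())

  defines₁ : ∀ ψ {R : Quadruple → Set} → (∀ x → ⟦ ψ ⟧∃ (x ++ []) ⇔ R x) →
             ∀ x → ⟦ onQuadruples₁ ψ (lens (x ∷ [])) ⟧Σ (concatT (x ∷ [])) ⇔ Lift₁ R (asQuadruple x)
  defines₁ ψ {R} ψ⇔R (n , xs) = go (n ≟ 4) xs
    where
    go : ∀ {n} (d : Dec (n ≡ 4)) xs → ⟦ ifQuadruple₁ d ψ ⟧Σ (xs ++ []) ⇔ Lift₁ R (quadruple? d xs)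
    go (yes ≡.refl) xs = ⇔-trans (⟦finitary⟧ ψ (xs ++ [])) (ψ⇔R xs)
    go (no _)       xs = ⟦⊥ᶠ⟧ (xs ++ [])

  defines₂ : ∀ ψ {R : Quadruple → Quadruple → Set} → (∀ x y → ⟦ ψ ⟧∃ (x ++ (y ++ [])) ⇔ R x y) →
             ∀ x y → ⟦ onQuadruples₂ ψ (lens (x ∷ y ∷ [])) ⟧Σ (concatT (x ∷ y ∷ [])) ⇔
                     Lift₂ R (asQuadruple x) (asQuadruple y)
  defines₂ ψ {R} ψ⇔R (n₁ , xs) (n₂ , ys) = go (n₁ ≟ 4) (n₂ ≟ 4) xs ys
    where
    go : ∀ {n₁ n₂} (d₁ : Dec (n₁ ≡ 4)) (d₂ : Dec (n₂ ≡ 4)) xs ys →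
         ⟦ ifQuadruples₂ d₁ d₂ ψ ⟧Σ (xs ++ (ys ++ [])) ⇔ Lift₂ R (quadruple? d₁ xs) (quadruple? d₂ ys)
    go (yes ≡.refl) (yes ≡.refl) xs ys = ⇔-trans (⟦finitary⟧ ψ (xs ++ (ys ++ []))) (ψ⇔R xs ys)
    go (no _)       _            xs ys = ⟦⊥ᶠ⟧ (xs ++ (ys ++ []))
    go (yes ≡.refl) (no _)       xs ys = ⟦⊥ᶠ⟧ (xs ++ (ys ++ []))

  defines₃ : ∀ ψ {R : Quadruple → Quadruple → Quadruple → Set} →
             (∀ x y z → ⟦ ψ ⟧∃ (x ++ (y ++ (z ++ []))) ⇔ R x y z) →
             ∀ x y z → ⟦ onQuadruples₃ ψ (lens (x ∷ y ∷ z ∷ [])) ⟧Σ (concatT (x ∷ y ∷ z ∷ [])) ⇔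
                       Lift₃ R (asQuadruple x) (asQuadruple y) (asQuadruple z)
  defines₃ ψ {R} ψ⇔R (n₁ , xs) (n₂ , ys) (n₃ , zs) = go (n₁ ≟ 4) (n₂ ≟ 4) (n₃ ≟ 4) xs ys zs
    where
    go : ∀ {n₁ n₂ n₃} (d₁ : Dec (n₁ ≡ 4)) (d₂ : Dec (n₂ ≡ 4)) (d₃ : Dec (n₃ ≡ 4)) xs ys zs →
         ⟦ ifQuadruples₃ d₁ d₂ d₃ ψ ⟧Σ (xs ++ (ys ++ (zs ++ []))) ⇔
         Lift₃ R (quadruple? d₁ xs) (quadruple? d₂ ys) (quadruple? d₃ zs)
    go (yes ≡.refl) (yes ≡.refl) (yes ≡.refl) xs ys zs =
      ⇔-trans (⟦finitary⟧ ψ (xs ++ (ys ++ (zs ++ [])))) (ψ⇔R xs ys zs)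
    go (no _)       _            _            xs ys zs = ⟦⊥ᶠ⟧ (xs ++ (ys ++ (zs ++ [])))
    go (yes ≡.refl) (no _)       _            xs ys zs = ⟦⊥ᶠ⟧ (xs ++ (ys ++ (zs ++ [])))
    go (yes ≡.refl) (yes ≡.refl) (no _)       xs ys zs = ⟦⊥ᶠ⟧ (xs ++ (ys ++ (zs ++ [])))

  domain-formula : ∀ x → ⟦ domainψ ⟧∃ (x ++ []) ⇔ InDomain x
  domain-formula (_ ∷ _ ∷ _ ∷ _ ∷ []) = mk⇔ proj₂ ([] ,_)

  equivalence-formula : ∀ x y → ⟦ equivalenceψ ⟧∃ (x ++ (y ++ [])) ⇔ EquivalentInDomain x y
  equivalence-formula (_ ∷ _ ∷ _ ∷ _ ∷ []) (_ ∷ _ ∷ _ ∷ _ ∷ []) = mk⇔ proj₂ ([] ,_)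

  inequivalence-formula : ∀ x y → ⟦ inequivalenceψ ⟧∃ (x ++ (y ++ [])) ⇔
                                  ((InDomain x × InDomain y) × ¬ EquivalentInDomain x y)
  inequivalence-formula (_ ∷ _ ∷ _ ∷ _ ∷ []) (_ ∷ _ ∷ _ ∷ _ ∷ []) =
    mk⇔ (λ (_ , d , ¬eq) → d , λ (_ , eq) → ¬eq eq) (λ (d , ¬eq) → [] , d , λ eq → ¬eq (d , eq))

  sum-formula : ∀ x y z → ⟦ sumψ ⟧∃ (x ++ (y ++ (z ++ []))) ⇔ Operation Sum x y z
  sum-formula (_ ∷ _ ∷ _ ∷ _ ∷ []) (_ ∷ _ ∷ _ ∷ _ ∷ []) (_ ∷ _ ∷ _ ∷ _ ∷ []) = ⇔-refl

  product-formula : ∀ x y z → ⟦ productψ ⟧∃ (x ++ (y ++ (z ++ []))) ⇔ Operation Product x y z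
  product-formula (_ ∷ _ ∷ _ ∷ _ ∷ []) (_ ∷ _ ∷ _ ∷ _ ∷ []) (_ ∷ _ ∷ _ ∷ _ ∷ []) = ⇔-refl

  nonsum-formula : ∀ x y z → ⟦ nonsumψ ⟧∃ (x ++ (y ++ (z ++ []))) ⇔
                             (Σ[ ws ∈ Quadruple ] (Valid x y z ws × ¬ Sum x ws))
  nonsum-formula (_ ∷ _ ∷ _ ∷ _ ∷ []) (_ ∷ _ ∷ _ ∷ _ ∷ []) (_ ∷ _ ∷ _ ∷ _ ∷ []) = ⇔-refl

  nonproduct-formula : ∀ x y z → ⟦ nonproductψ ⟧∃ (x ++ (y ++ (z ++ []))) ⇔
                                 (Σ[ ws ∈ Quadruple ] (Valid x y z ws × ¬ Product x ws))
  nonproduct-formula (_ ∷ _ ∷ _ ∷ _ ∷ []) (_ ∷ _ ∷ _ ∷ _ ∷ []) (_ ∷ _ ∷ _ ∷ _ ∷ []) = ⇔-refl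

record QuadrupleInterpretation (B : GroupLangStr) (F : FieldOnω) : Set₁ where
  open FormulaSemantics B
  module F = FieldOnω F
  field
    value            : ∀ x → InDomain x → F.Carrier
    value-surjective : ∀ a → Σ[ x ∈ Quadruple ] Σ[ d ∈ InDomain x ] value x d F.≈ a
    equivalent⇔      : ∀ x y (dx : InDomain x) (dy : InDomain y) →
                       Equivalent x y ⇔ value x dx F.≈ value y dy
    witnesses        : ∀ x y z → InDomain x → InDomain y → InDomain z →
                       Σ[ ws ∈ Quadruple ] Valid x y z ws
    sum⇔             : ∀ x y z ws → Valid x y z ws →
                       (dx : InDomain x) (dy : InDomain y) (dz : InDomain z) →
                       Sum x ws ⇔ (value x dx F.+ value y dy F.≈ value z dz)
    product⇔         : ∀ x y z ws → Valid x y z ws →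
                       (dx : InDomain x) (dy : InDomain y) (dz : InDomain z) →
                       Product x ws ⇔ (value x dx F.* value y dy F.≈ value z dz)

module _ {B : GroupLangStr} {F : FieldOnω} (I : QuadrupleInterpretation B F) where
  open FormulaSemantics B
  open Sem B
  open QuadrupleInterpretation I

  D : Tuple → Set
  D x = Lift₁ InDomain (asQuadruple x)

  _∼_ : Tuple → Tuple → Set
  x ∼ y = Lift₂ EquivalentInDomain (asQuadruple x) (asQuadruple y)

  Graph : (Quadruple → Quadruple → Set) → Tuple → Tuple → Tuple → Set
  Graph Body x y z = Lift₃ (Operation Body) (asQuadruple x) (asQuadruple y) (asQuadruple z)

  valueᴹ : ∀ m → Lift₁ InDomain m → F.Carrier
  valueᴹ (just x) = value x

  f : ∀ x → D x → F.Carrier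
  f x = valueᴹ (asQuadruple x)

  f-surjective : ∀ a → Σ[ x ∈ Tuple ] Σ[ d ∈ D x ] f x d F.≈ a
  f-surjective a = let (x , d , x↦a) = value-surjective a in (4 , x) , d , x↦a

  f-ker : ∀ x y (dx : D x) (dy : D y) → x ∼ y ⇔ f x dx F.≈ f y dy
  f-ker x y = go (asQuadruple x) (asQuadruple y)
    where
    go : ∀ m n (dm : Lift₁ InDomain m) (dn : Lift₁ InDomain n) →
         Lift₂ EquivalentInDomain m n ⇔ valueᴹ m dm F.≈ valueᴹ n dn
    go (just x) (just y) dx dy = ⇔-trans (mk⇔ proj₂ ((dx , dy) ,_)) (equivalent⇔ x y dx dy)

  ∼⊆D² : ∀ x y → x ∼ y → D x × D y
  ∼⊆D² x y = Lift₂-⊆ proj₁ (asQuadruple x) (asQuadruple y)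

  operands : ∀ x y z ws → Valid x y z ws → InDomain x × InDomain y × InDomain z
  operands _ _ _ _ (dx , dy , dz , _) = dx , dy , dz

  graph⊆D³ : ∀ Body x y z → Graph Body x y z → D x × D y × D z
  graph⊆D³ Body x y z =
    Lift₃-⊆ (λ {a} {b} {c} (ws , v , _) → operands a b c ws v)
            (asQuadruple x) (asQuadruple y) (asQuadruple z)

  complement₂ : ∀ ψ {R} → (∀ x y → ⟦ ψ ⟧∃ (x ++ (y ++ [])) ⇔ ((InDomain x × InDomain y) × ¬ R x y)) →
    ∀ x y → ⟦ onQuadruples₂ ψ (lens (x ∷ y ∷ [])) ⟧Σ (concatT (x ∷ y ∷ [])) ⇔
            (D x × D y × ¬ Lift₂ R (asQuadruple x) (asQuadruple y))
  complement₂ ψ ψ⇔ x y = ⇔-trans (defines₂ ψ ψ⇔ x y) (Lift₂-complement (asQuadruple x) (asQuadruple y))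

  module OperationOf (Body : Quadruple → Quadruple → Set) (_⊙_ : F.Carrier → F.Carrier → F.Carrier)
    (body⇔ : ∀ x y z ws → Valid x y z ws → (dx : InDomain x) (dy : InDomain y) (dz : InDomain z) →
             Body x ws ⇔ (value x dx ⊙ value y dy F.≈ value z dz)) where

    operation⇔ : ∀ x y z (dx : InDomain x) (dy : InDomain y) (dz : InDomain z) →
                 Operation Body x y z ⇔ (value x dx ⊙ value y dy F.≈ value z dz)
    operation⇔ x y z dx dy dz =
      ∃-valid⇔ (λ (dx , dy , dz) → witnesses x y z dx dy dz) (λ {ws} v → body⇔ x y z ws v dx dy dz)
        (dx , dy , dz)

    co-operation⇔ : ∀ x y z → (Σ[ ws ∈ Quadruple ] (Valid x y z ws × ¬ Body x ws)) ⇔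
                    ((InDomain x × InDomain y × InDomain z) × ¬ Operation Body x y z)
    co-operation⇔ x y z =
      ∃-valid-¬⇔ (λ (dx , dy , dz) → witnesses x y z dx dy dz) (λ {ws} → operands x y z ws) independent
      where
      independent : ∀ {ws ws'} → Valid x y z ws → Valid x y z ws' → Body x ws → Body x ws'
      independent {ws} {ws'} v v' =
        let (dx , dy , dz) = operands x y z ws v in
        Equivalence.from (body⇔ x y z ws' v' dx dy dz) ∘ Equivalence.to (body⇔ x y z ws v dx dy dz)

    f-homomorphic : ∀ x y z (dx : D x) (dy : D y) (dz : D z) →
                    Graph Body x y z ⇔ (f x dx ⊙ f y dy F.≈ f z dz)
    f-homomorphic x y z = go (asQuadruple x) (asQuadruple y) (asQuadruple z)
      where
      go : ∀ l m n (dl : Lift₁ InDomain l) (dm : Lift₁ InDomain m) (dn : Lift₁ InDomain n) →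
           Lift₃ (Operation Body) l m n ⇔ (valueᴹ l dl ⊙ valueᴹ m dm F.≈ valueᴹ n dn)
      go (just x) (just y) (just z) = operation⇔ x y z

    complement-defined : ∀ ψ → (∀ x y z → ⟦ ψ ⟧∃ (x ++ (y ++ (z ++ []))) ⇔
                                            (Σ[ ws ∈ Quadruple ] (Valid x y z ws × ¬ Body x ws))) →
      ∀ x y z → ⟦ onQuadruples₃ ψ (lens (x ∷ y ∷ z ∷ [])) ⟧Σ (concatT (x ∷ y ∷ z ∷ [])) ⇔
                (D x × D y × D z × ¬ Graph Body x y z)
    complement-defined ψ ψ⇔ x y z =
      ⇔-trans (defines₃ ψ (λ x y z → ⇔-trans (ψ⇔ x y z) (co-operation⇔ x y z)) x y z)
              (Lift₃-complement (asQuadruple x) (asQuadruple y) (asQuadruple z))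

  module Sums     = OperationOf Sum F._+_ sum⇔
  module Products = OperationOf Product F._*_ product⇔

  interpretation : DefinesEffInterp Φ B F
  interpretation = record
    { D      = D
    ; _∼_    = _∼_
    ; R₊     = Graph Sum
    ; R·     = Graph Product
    ; ∼⊆D²   = λ {x} {y} → ∼⊆D² x y
    ; R₊⊆D³  = λ {x} {y} {z} → graph⊆D³ Sum x y z
    ; R·⊆D³  = λ {x} {y} {z} → graph⊆D³ Product x y z
    ; defD   = λ { (x ∷ []) → defines₁ domainψ domain-formula x }
    ; def∼   = λ { (x ∷ y ∷ []) → defines₂ equivalenceψ equivalence-formula x y }
    ; def≁   = λ { (x ∷ y ∷ []) → complement₂ inequivalenceψ inequivalence-formula x y }
    ; defR₊  = λ { (x ∷ y ∷ z ∷ []) → defines₃ sumψ sum-formula x y z }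
    ; defNR₊ = λ { (x ∷ y ∷ z ∷ []) → Sums.complement-defined nonsumψ nonsum-formula x y z }
    ; defR·  = λ { (x ∷ y ∷ z ∷ []) → defines₃ productψ product-formula x y z }
    ; defNR· = λ { (x ∷ y ∷ z ∷ []) → Products.complement-defined nonproductψ nonproduct-formula x y z }
    ; f      = f
    ; f-surj = f-surjective
    ; f-ker  = f-ker
    ; f-add  = Sums.f-homomorphic
    ; f-mul  = Products.f-homomorphic
    }

-- The Heisenberg group

module HeisenbergGroup (F : FieldOnω) where
  open FieldOnω F hiding (zero)
  open Heisenberg F
  open FormulaSemantics (H F) using (Quadruple; InDomain; Equivalent; Sum; Product; Valid)
  open Determinant commRing
  open FieldDeterminant field′
  open CommutativeRingSolver commRing using (solve; _:=_; _:+_; _:*_; :-_; _:-_)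
  open import Algebra.Properties.AbelianGroup +-abelianGroup using (⁻¹-∙-comm)
  open import Algebra.Properties.Group +-group using (ε⁻¹≈ε)
  open import Relation.Binary.Reasoning.Setoid setoid
  open Equivalence using (to; from)

  infix 4 _≈³_
  _≈³_ : Elt → Elt → Set
  _≈³_ = Pointwise _≈_ (Pointwise _≈_ _≈_)

  module ≈³ = Setoid (×-setoid setoid (×-setoid setoid setoid))

  ≈H⇒≈³ : ∀ {x y} → x ≈H y → x ≈³ y
  ≈H⇒≈³ x≈y = x≈y zero (suc zero) , x≈y (suc zero) (suc (suc zero)) , x≈y zero (suc (suc zero))

  ≈³⇒≈H : ∀ {x y} → x ≈³ y → x ≈H y
  ≈³⇒≈H _           zero             zero             = refl
  ≈³⇒≈H (a , _ , _) zero             (suc zero)       = a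
  ≈³⇒≈H (_ , _ , c) zero             (suc (suc zero)) = c
  ≈³⇒≈H _           (suc zero)       zero             = refl
  ≈³⇒≈H _           (suc zero)       (suc zero)       = refl
  ≈³⇒≈H (_ , b , _) (suc zero)       (suc (suc zero)) = b
  ≈³⇒≈H _           (suc (suc zero)) zero             = refl
  ≈³⇒≈H _           (suc (suc zero)) (suc zero)       = refl
  ≈³⇒≈H _           (suc (suc zero)) (suc (suc zero)) = refl

  _∙ⁿ_ : Elt → Elt → Elt
  (a , b , c) ∙ⁿ (a' , b' , c') = a' + a , b' + b , (c' + a * b') + c

  ∙H≈∙ⁿ : ∀ x y → x ∙H y ≈³ x ∙ⁿ y
  ∙H≈∙ⁿ (a , b , c) (a' , b' , c') =
    trans (+-cong (+-cong (*-identityˡ a') (*-identityʳ a)) (zeroʳ c)) (+-identityʳ (a' + a)) ,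
    +-cong (trans (+-cong (zeroˡ c') (*-identityˡ b')) (+-identityˡ b')) (*-identityʳ b) ,
    +-cong (+-congʳ (*-identityˡ c')) (*-identityʳ c)

  ∙ⁿ-cong : ∀ {x x' y y'} → x ≈³ x' → y ≈³ y' → x ∙ⁿ y ≈³ x' ∙ⁿ y'
  ∙ⁿ-cong (a , b , c) (a' , b' , c') = +-cong a' a , +-cong b' b , +-cong (+-cong c' (*-cong a b')) c

  ⁅_,_⁆ : Elt → Elt → Elt
  ⁅ x , y ⁆ = (invH x ∙H invH y) ∙H (x ∙H y)

  π : Elt → R²
  π (a , b , _) = a , b

  κ : Elt → Elt → Carrier
  κ x y = det (π x) (π y)

  central : Carrier → Elt
  central c = 0# , 0# , c

  commutator-central : ∀ x y → ⁅ x , y ⁆ ≈³ central (κ x y)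
  commutator-central (a , b , c) (a' , b' , c') =
    ≈³.trans (∙H≈∙ⁿ _ _)
      (≈³.trans (∙ⁿ-cong (∙H≈∙ⁿ _ _) (∙H≈∙ⁿ _ _)) (cancel a' a , cancel b' b , κ-entry))
    where
    cancel : ∀ r s → (r + s) + (- r + - s) ≈ 0#
    cancel r s = trans (+-congˡ (⁻¹-∙-comm r s)) (-‿inverseʳ (r + s))
    κ-entry : ((c' + a * b') + c + (- a' + - a) * (b' + b)) + ((a' * b' - c') + - a * - b' + (a * b - c))
              ≈ a * b' - b * a'
    κ-entry = solve 6 (λ a b c a' b' c' →
      ((c' :+ a :* b') :+ c :+ (:- a' :+ :- a) :* (b' :+ b))
        :+ ((a' :* b' :- c') :+ :- a :* :- b' :+ (a :* b :- c))
        := a :* b' :- b :* a') refl a b c a' b' c'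

  ∙ⁿ-central : ∀ c c' → central c ∙ⁿ central c' ≈³ central (c + c')
  ∙ⁿ-central c c' =
    +-identityʳ 0# , +-identityʳ 0# ,
    trans (+-congʳ (trans (+-congˡ (zeroˡ 0#)) (+-identityʳ c'))) (+-comm c' c)

  central-≈H⇔ : ∀ {x y c c'} → x ≈³ central c → y ≈³ central c' → x ≈H y ⇔ c ≈ c'
  central-≈H⇔ x≈c y≈c' = mk⇔
    (λ x≈y → proj₂ (proj₂ (≈³.trans (≈³.sym x≈c) (≈³.trans (≈H⇒≈³ x≈y) y≈c'))))
    (λ c≈c' → ≈³⇒≈H (≈³.trans x≈c (≈³.trans (refl , refl , c≈c') (≈³.sym y≈c'))))

  ⁅⁆≈ε⇔ : ∀ {x y} → ⁅ x , y ⁆ ≈H eH ⇔ κ x y ≈ 0#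
  ⁅⁆≈ε⇔ {x} {y} = central-≈H⇔ (commutator-central x y) ≈³.refl

  ⁅⁆≈⁅⁆⇔ : ∀ {x y x' y'} → ⁅ x , y ⁆ ≈H ⁅ x' , y' ⁆ ⇔ κ x y ≈ κ x' y'
  ⁅⁆≈⁅⁆⇔ {x} {y} {x'} {y'} = central-≈H⇔ (commutator-central x y) (commutator-central x' y')

  ⁅⁆∙⁅⁆≈⁅⁆⇔ : ∀ {x y x' y' x'' y''} →
    (⁅ x , y ⁆ ∙H ⁅ x' , y' ⁆) ≈H ⁅ x'' , y'' ⁆ ⇔ κ x y + κ x' y' ≈ κ x'' y''
  ⁅⁆∙⁅⁆≈⁅⁆⇔ {x} {y} {x'} {y'} {x''} {y''} = central-≈H⇔
    (≈³.trans (∙H≈∙ⁿ _ _)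
      (≈³.trans (∙ⁿ-cong (commutator-central x y) (commutator-central x' y')) (∙ⁿ-central _ _)))
    (commutator-central x'' y'')

  Represents : Quadruple → Carrier → Set
  Represents (u ∷ v ∷ p ∷ q ∷ []) t = π p ≈² t ⋆ π u × π q ≈² t ⋆ π v

  _⋆ₕ_ : Carrier → Elt → Elt
  t ⋆ₕ (a , b , _) = t * a , t * b , 0#

  scaled-represents : ∀ u v t → Represents (u ∷ v ∷ t ⋆ₕ u ∷ t ⋆ₕ v ∷ []) t
  scaled-represents u v t = ≈².refl , ≈².refl

  nonzero-basis : ∀ {u v p q} → InDomain (u ∷ v ∷ p ∷ q ∷ []) → ¬ κ u v ≈ 0#
  nonzero-basis (u≁v , _) = u≁v ∘ from ⁅⁆≈ε⇔

  value : ∀ x → InDomain x → Carrier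
  value (u ∷ v ∷ p ∷ q ∷ []) d = κ p v * proj₁ (inverse (κ u v) (nonzero-basis d))

  represents-value : ∀ x (d : InDomain x) → Represents x (value x d)
  represents-value (u ∷ v ∷ p ∷ q ∷ []) d@(_ , u⊥p , q⊥v , pv≈uq) =
    proportionalˡ uv*y≈1 (to ⁅⁆≈ε⇔ u⊥p) ,
    ≈².trans (proportionalʳ uv*y≈1 (to ⁅⁆≈ε⇔ q⊥v)) (⋆-congʳ (π v) (*-congʳ (sym (to ⁅⁆≈⁅⁆⇔ pv≈uq))))
    where
    uv*y≈1 = proj₂ (inverse (κ u v) (nonzero-basis d))

  represented-value : ∀ x {t} (d : InDomain x) → Represents x t → value x d ≈ t
  represented-value (u ∷ v ∷ p ∷ q ∷ []) {t} d (p≈tu , _) = begin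
    κ p v * y        ≈⟨ *-congʳ (det-proportionalˡ (π v) p≈tu) ⟩
    (t * κ u v) * y  ≈⟨ *-assoc t (κ u v) y ⟩
    t * (κ u v * y)  ≈⟨ *-congˡ (proj₂ (inverse (κ u v) (nonzero-basis d))) ⟩
    t * 1#           ≈⟨ *-identityʳ t ⟩
    t                ∎
    where
    y = proj₁ (inverse (κ u v) (nonzero-basis d))

  represented-inDomain : ∀ {u v p q t} → ¬ ⁅ u , v ⁆ ≈H eH →
                         Represents (u ∷ v ∷ p ∷ q ∷ []) t → InDomain (u ∷ v ∷ p ∷ q ∷ [])
  represented-inDomain {u} {v} {t = t} u≁v (p≈tu , q≈tv) =
    u≁v ,
    from ⁅⁆≈ε⇔ (trans (det-proportionalʳ (π u) p≈tu) (vanish u)) ,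
    from ⁅⁆≈ε⇔ (trans (det-proportionalˡ (π v) q≈tv) (vanish v)) ,
    from ⁅⁆≈⁅⁆⇔ (trans (det-proportionalˡ (π v) p≈tu) (sym (det-proportionalʳ (π u) q≈tv)))
    where
    vanish : ∀ w → t * κ w w ≈ 0#
    vanish w = trans (*-congˡ (det-self (π w))) (zeroʳ t)

  commutators-agree⇔ : ∀ {a a₀ b b₀ s t} → π a ≈² s ⋆ π a₀ → π b ≈² t ⋆ π b₀ →
                       ⁅ a , b₀ ⁆ ≈H ⁅ a₀ , b ⁆ ⇔ s * κ a₀ b₀ ≈ t * κ a₀ b₀
  commutators-agree⇔ {a₀ = a₀} {b₀ = b₀} a≈sa₀ b≈tb₀ =
    ⇔-trans ⁅⁆≈⁅⁆⇔ (≈-resp-⇔ setoid (det-proportionalˡ (π b₀) a≈sa₀) (det-proportionalʳ (π a₀) b≈tb₀))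

  equivalent⇔ : ∀ x y (dx : InDomain x) (dy : InDomain y) → Equivalent x y ⇔ value x dx ≈ value y dy
  equivalent⇔ x@(u ∷ v ∷ p ∷ q ∷ []) y@(u' ∷ v' ∷ p' ∷ q' ∷ []) dx dy =
    ⇔-trans (commutators-agree⇔ p≈tu p'≈t'u' ×-⇔ commutators-agree⇔ p≈tu q'≈t'v')
            (scalars-agree⇔ (nonzero-basis dx) (nonzero-basis dy))
    where
    p≈tu = proj₁ (represents-value x dx)
    p'≈t'u' = proj₁ (represents-value y dy)
    q'≈t'v' = proj₂ (represents-value y dy)

  sum-represented⇔ : ∀ {u v p q P₁ Q₁ P₂ Q₂ t t₁ t₂} → ¬ κ u v ≈ 0# →
    Represents (u ∷ v ∷ p ∷ q ∷ []) t → Represents (u ∷ v ∷ P₁ ∷ Q₁ ∷ []) t₁ →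
    Represents (u ∷ v ∷ P₂ ∷ Q₂ ∷ []) t₂ →
    (⁅ p , v ⁆ ∙H ⁅ P₁ , v ⁆) ≈H ⁅ P₂ , v ⁆ ⇔ t + t₁ ≈ t₂
  sum-represented⇔ {u} {v} {p} {P₁ = P₁} {t = t} {t₁} {t₂} uv≉0 (p≈tu , _) (P₁≈t₁u , _) (P₂≈t₂u , _) =
    ⇔-trans ⁅⁆∙⁅⁆≈⁅⁆⇔
      (⇔-trans (≈-resp-⇔ setoid sum-entry (det-proportionalˡ (π v) P₂≈t₂u)) (*-cancelʳ-⇔ uv≉0))
    where
    sum-entry : κ p v + κ P₁ v ≈ (t + t₁) * κ u v
    sum-entry = trans (+-cong (det-proportionalˡ (π v) p≈tu) (det-proportionalˡ (π v) P₁≈t₁u))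
                      (sym (distribʳ (κ u v) t t₁))

  product-represented⇔ : ∀ {u v p q P₁ Q₁ P₂ Q₂ t t₁ t₂} → ¬ κ u v ≈ 0# →
    Represents (u ∷ v ∷ p ∷ q ∷ []) t → Represents (u ∷ v ∷ P₁ ∷ Q₁ ∷ []) t₁ →
    Represents (u ∷ v ∷ P₂ ∷ Q₂ ∷ []) t₂ →
    ⁅ p , Q₁ ⁆ ≈H ⁅ P₂ , v ⁆ ⇔ t * t₁ ≈ t₂
  product-represented⇔ {u} {v} {p} {Q₁ = Q₁} {t = t} {t₁} {t₂}
                       uv≉0 (p≈tu , _) (_ , Q₁≈t₁v) (P₂≈t₂u , _) =
    ⇔-trans ⁅⁆≈⁅⁆⇔
      (⇔-trans (≈-resp-⇔ setoid product-entry (det-proportionalˡ (π v) P₂≈t₂u)) (*-cancelʳ-⇔ uv≉0))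
    where
    product-entry : κ p Q₁ ≈ (t * t₁) * κ u v
    product-entry = begin
      κ p Q₁             ≈⟨ det-proportionalˡ (π Q₁) p≈tu ⟩
      t * κ u Q₁         ≈⟨ *-congˡ (det-proportionalʳ (π u) Q₁≈t₁v) ⟩
      t * (t₁ * κ u v)   ≈⟨ *-assoc t t₁ (κ u v) ⟨
      (t * t₁) * κ u v   ∎

  witnesses : ∀ x y z → InDomain x → InDomain y → InDomain z → Σ[ ws ∈ Quadruple ] Valid x y z ws
  witnesses (u ∷ v ∷ p ∷ q ∷ []) y z dx@(u≁v , _) dy dz =
    (t₁ ⋆ₕ u ∷ t₁ ⋆ₕ v ∷ t₂ ⋆ₕ u ∷ t₂ ⋆ₕ v ∷ []) ,
    dx , dy , dz ,
    dw₁ , from (equivalent⇔ w₁ y dw₁ dy) (represented-value w₁ dw₁ (scaled-represents u v t₁)) ,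
    dw₂ , from (equivalent⇔ w₂ z dw₂ dz) (represented-value w₂ dw₂ (scaled-represents u v t₂))
    where
    t₁ = value y dy
    t₂ = value z dz
    w₁ = u ∷ v ∷ t₁ ⋆ₕ u ∷ t₁ ⋆ₕ v ∷ []
    w₂ = u ∷ v ∷ t₂ ⋆ₕ u ∷ t₂ ⋆ₕ v ∷ []
    dw₁ = represented-inDomain u≁v (scaled-represents u v t₁)
    dw₂ = represented-inDomain u≁v (scaled-represents u v t₂)

  represents-cong : ∀ x {s t} → s ≈ t → Represents x s → Represents x t
  represents-cong (u ∷ v ∷ _ ∷ _ ∷ []) s≈t (p≈su , q≈sv) =
    ≈².trans p≈su (⋆-congʳ (π u) s≈t) , ≈².trans q≈sv (⋆-congʳ (π v) s≈t)

  witnesses-represent : ∀ x y z ws → Valid x y z ws → (dy : InDomain y) (dz : InDomain z) →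
    Represents (witness₁ x ws) (value y dy) × Represents (witness₂ x ws) (value z dz)
  witnesses-represent x y z ws (_ , _ , _ , dw₁ , w₁∼y , dw₂ , w₂∼z) dy dz =
    represents-cong w₁ (to (equivalent⇔ w₁ y dw₁ dy) w₁∼y) (represents-value w₁ dw₁) ,
    represents-cong w₂ (to (equivalent⇔ w₂ z dw₂ dz) w₂∼z) (represents-value w₂ dw₂)
    where
    w₁ = witness₁ x ws
    w₂ = witness₂ x ws

  sum⇔ : ∀ x y z ws → Valid x y z ws → (dx : InDomain x) (dy : InDomain y) (dz : InDomain z) →
         Sum x ws ⇔ (value x dx + value y dy ≈ value z dz)
  sum⇔ x@(u ∷ v ∷ p ∷ q ∷ []) y z ws@(P₁ ∷ Q₁ ∷ P₂ ∷ Q₂ ∷ []) valid dx dy dz =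
    sum-represented⇔ {u} {v} {p} {q} {P₁} {Q₁} {P₂} {Q₂}
      (nonzero-basis dx) (represents-value x dx) (proj₁ w↦yz) (proj₂ w↦yz)
    where
    w↦yz = witnesses-represent x y z ws valid dy dz

  product⇔ : ∀ x y z ws → Valid x y z ws → (dx : InDomain x) (dy : InDomain y) (dz : InDomain z) →
             Product x ws ⇔ (value x dx * value y dy ≈ value z dz)
  product⇔ x@(u ∷ v ∷ p ∷ q ∷ []) y z ws@(P₁ ∷ Q₁ ∷ P₂ ∷ Q₂ ∷ []) valid dx dy dz =
    product-represented⇔ {u} {v} {p} {q} {P₁} {Q₁} {P₂} {Q₂}
      (nonzero-basis dx) (represents-value x dx) (proj₁ w↦yz) (proj₂ w↦yz)
    where
    w↦yz = witnesses-represent x y z ws valid dy dz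

  value-surjective : ∀ t → Σ[ x ∈ Quadruple ] Σ[ d ∈ InDomain x ] value x d ≈ t
  value-surjective t = x , d , represented-value x d (scaled-represents u₀ v₀ t)
    where
    u₀ v₀ : Elt
    u₀ = 1# , 0# , 0#
    v₀ = 0# , 1# , 0#
    κu₀v₀≈1 : κ u₀ v₀ ≈ 1#
    κu₀v₀≈1 = trans (+-cong (*-identityˡ 1#) (trans (-‿cong (zeroˡ 0#)) ε⁻¹≈ε)) (+-identityʳ 1#)
    x = u₀ ∷ v₀ ∷ t ⋆ₕ u₀ ∷ t ⋆ₕ v₀ ∷ []
    d : InDomain x
    d = represented-inDomain {u₀} {v₀} {t ⋆ₕ u₀} {t ⋆ₕ v₀} {t}
          (λ u₀v₀≈e → 0≉1 (trans (sym (to ⁅⁆≈ε⇔ u₀v₀≈e)) κu₀v₀≈1)) (scaled-represents u₀ v₀ t)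

  quadruples : QuadrupleInterpretation (H F) F
  quadruples = record
    { value            = value
    ; value-surjective = value-surjective
    ; equivalent⇔      = equivalent⇔
    ; witnesses        = witnesses
    ; sum⇔             = sum⇔
    ; product⇔         = product⇔
    }

corollary3p4 : Σ[ Φ ∈ InterpFormulas ] ((F : FieldOnω) → DefinesEffInterp Φ (H F) F)
corollary3p4 = Φ , λ F → interpretation (HeisenbergGroup.quadruples F)
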